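{- Let $K$ be a finite simplicial complex and $\sigma\in K$ a simplex. If $\sigma$ is not a face simplex of $K$, then $\mathrm{link}_K\,\sigma$ is contractible.
   Context: A simplex $\tau\in K$ is called a face simplex if it can be represented as an intersection $\tau=\sigma_1\cap\dots\cap\sigma_s$ ($s\ge1$) of inclusion-maximal simplices $\sigma_1,\dots,\sigma_s$ of $K$. The link is $\mathrm{link}_K\sigma=\{\tau\in K\mid\tau\cap\sigma=\varnothing,\ \tau\cup\sigma\in K\}$; topological properties refer to geometric realizations. -}

module Defs where

open import Data.Bool.Properties as Bool using ()
open import Data.Fin.Subset using (Subset; ⊥; _∈_; _∉_; _⊆_; _∩_; _∪_; ⋂)
open import Data.Fin.Subset.Properties
  using (⊆-antisym; ⊆-min; x∈p∩q⁺; x∈p∩q⁻; x∈p∪q⁺; x∈p∪q⁻; ∩-zeroˡ; ∪-identityˡ)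
open import Data.List.NonEmpty.Base using (List⁺; toList)
open import Data.List.Relation.Unary.All using (All)
open import Data.Nat.Base as ℕ using (ℕ; suc; _⊔_)
open import Data.Nat.Properties as ℕ using (m⊔n≤o⇒m≤o; m⊔n≤o⇒n≤o)
open import Data.Product.Base using (Σ-syntax; ∃; ∃-syntax; _×_; _,_; proj₁)
open import Data.Rational.Base as ℚ using (ℚ; 0ℚ; 1ℚ; ½)
open import Data.Rational.Properties as ℚ using ()
open import Data.Rational.Solver using (module +-*-Solver)
open import Data.Sum.Base using (inj₁; inj₂; map₁)
open import Data.Vec.Functional using (Vector; head; tail; foldr; _∷_)
open import Data.Vec.Properties using (≡-dec)
open import Level using (0ℓ)
open import Relation.Binary.PropositionalEquality
  using (_≡_; refl; sym; trans; cong; cong₂; subst; subst₂)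
open import Relation.Nullary.Decidable using (_×-dec_)
open import Relation.Unary using (Pred; Decidable)

------------------------------------------------------------------------
-- Real numbers: Cauchy sequences of rationals, compared by the setoid
-- equality _≈_ (the difference tends to 0).

IsCauchy : (ℕ → ℚ) → Set
IsCauchy s = ∀ ε → 0ℚ ℚ.< ε →
  ∃[ N ] (∀ m n → N ℕ.≤ m → N ℕ.≤ n → ℚ.∣ s m ℚ.- s n ∣ ℚ.< ε)

record ℝ : Set where
  constructor mkℝ
  field
    seq    : ℕ → ℚ
    cauchy : IsCauchy seq

open ℝ public

infix 4 _≈_ _≤_ _<_

_≈_ : ℝ → ℝ → Set
x ≈ y = ∀ ε → 0ℚ ℚ.< ε →
  ∃[ N ] (∀ n → N ℕ.≤ n → ℚ.∣ seq x n ℚ.- seq y n ∣ ℚ.< ε)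

_≤_ : ℝ → ℝ → Set
x ≤ y = ∀ ε → 0ℚ ℚ.< ε →
  ∃[ N ] (∀ n → N ℕ.≤ n → seq x n ℚ.≤ seq y n ℚ.+ ε)

_<_ : ℝ → ℝ → Set
x < y = ∃[ ε ] (0ℚ ℚ.< ε ×
  ∃[ N ] (∀ n → N ℕ.≤ n → seq x n ℚ.+ ε ℚ.≤ seq y n))

fromℚ : ℚ → ℝ
fromℚ q = mkℝ (λ _ → q) λ ε 0<ε →
  0 , λ _ _ _ _ → subst (ℚ._< ε) (sym (cong ℚ.∣_∣ (ℚ.+-inverseʳ q))) 0<ε

0ℝ 1ℝ : ℝ
0ℝ = fromℚ 0ℚ
1ℝ = fromℚ 1ℚ

infixl 6 _+_ _-_
infix  8 -_

_+_ : ℝ → ℝ → ℝ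
x + y = mkℝ (λ n → seq x n ℚ.+ seq y n) λ ε 0<ε →
  let 0<ε/2    = subst (ℚ._< ½ ℚ.* ε) (ℚ.*-zeroʳ ½) (ℚ.*-monoʳ-<-pos ½ 0<ε)
      (M , xM) = cauchy x (½ ℚ.* ε) 0<ε/2
      (N , yN) = cauchy y (½ ℚ.* ε) 0<ε/2
  in M ⊔ N , λ m n ≤m ≤n →
       subst₂ ℚ._<_ (cong ℚ.∣_∣ (interchange (seq x m) (seq x n) (seq y m) (seq y n))) (halves ε)
         (ℚ.≤-<-trans (ℚ.∣p+q∣≤∣p∣+∣q∣ (seq x m ℚ.- seq x n) (seq y m ℚ.- seq y n))
           (ℚ.+-mono-<
             (xM m n (m⊔n≤o⇒m≤o M N ≤m) (m⊔n≤o⇒m≤o M N ≤n))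
             (yN m n (m⊔n≤o⇒n≤o M N ≤m) (m⊔n≤o⇒n≤o M N ≤n))))
  where
  open +-*-Solver
  interchange : ∀ a b c d → (a ℚ.- b) ℚ.+ (c ℚ.- d) ≡ (a ℚ.+ c) ℚ.- (b ℚ.+ d)
  interchange = solve 4 (λ a b c d → (a :- b) :+ (c :- d) := (a :+ c) :- (b :+ d)) refl
  halves : ∀ ε → ½ ℚ.* ε ℚ.+ ½ ℚ.* ε ≡ ε
  halves ε = trans (sym (ℚ.*-distribʳ-+ ε ½ ½)) (ℚ.*-identityˡ ε)

-_ : ℝ → ℝ
- x = mkℝ (λ n → ℚ.- seq x n) λ ε 0<ε →
  let (N , xN) = cauchy x ε 0<ε
  in N , λ m n N≤m N≤n →
       subst (ℚ._< ε)
         (trans (sym (ℚ.∣-p∣≡∣p∣ (seq x m ℚ.- seq x n)))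
                (cong ℚ.∣_∣ (ℚ.neg-distrib-+ (seq x m) (ℚ.- seq x n))))
         (xN m n N≤m N≤n)

_-_ : ℝ → ℝ → ℝ
x - y = x + - y

∣_∣ : ℝ → ℝ
∣ x ∣ = mkℝ (λ n → ℚ.∣ seq x n ∣) λ ε 0<ε →
  let (N , xN) = cauchy x ε 0<ε
  in N , λ m n N≤m N≤n → ℚ.≤-<-trans (reverse-triangle (seq x m) (seq x n)) (xN m n N≤m N≤n)
  where
  open +-*-Solver
  split : ∀ p q → (p ℚ.- q) ℚ.+ q ≡ p
  split = solve 2 (λ p q → (p :- q) :+ q := p) refl
  cancel : ∀ a b → (a ℚ.+ b) ℚ.- b ≡ a
  cancel = solve 2 (λ a b → (a :+ b) :- b := a) refl
  flip : ∀ p q → ℚ.- (p ℚ.- q) ≡ q ℚ.- p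
  flip = solve 2 (λ p q → :- (p :- q) := q :- p) refl
  one-sided : ∀ p q → ℚ.∣ p ∣ ℚ.- ℚ.∣ q ∣ ℚ.≤ ℚ.∣ p ℚ.- q ∣
  one-sided p q =
    subst (ℚ.∣ p ∣ ℚ.- ℚ.∣ q ∣ ℚ.≤_) (cancel ℚ.∣ p ℚ.- q ∣ ℚ.∣ q ∣)
      (ℚ.+-monoˡ-≤ (ℚ.- ℚ.∣ q ∣)
        (subst (λ r → ℚ.∣ r ∣ ℚ.≤ ℚ.∣ p ℚ.- q ∣ ℚ.+ ℚ.∣ q ∣) (split p q)
          (ℚ.∣p+q∣≤∣p∣+∣q∣ (p ℚ.- q) q)))
  reverse-triangle : ∀ p q → ℚ.∣ ℚ.∣ p ∣ ℚ.- ℚ.∣ q ∣ ∣ ℚ.≤ ℚ.∣ p ℚ.- q ∣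
  reverse-triangle p q with ℚ.∣p∣≡p∨∣p∣≡-p (ℚ.∣ p ∣ ℚ.- ℚ.∣ q ∣)
  ... | inj₁ e = subst (ℚ._≤ ℚ.∣ p ℚ.- q ∣) (sym e) (one-sided p q)
  ... | inj₂ e = subst₂ ℚ._≤_
    (sym (trans e (flip ℚ.∣ p ∣ ℚ.∣ q ∣)))
    (trans (cong ℚ.∣_∣ (sym (flip p q))) (ℚ.∣-p∣≡∣p∣ (p ℚ.- q)))
    (one-sided q p)

∑ : ∀ {n} → Vector ℝ n → ℝ
∑ = foldr _+_ 0ℝ

------------------------------------------------------------------------
-- Subspaces of ℝⁿ and continuous maps between them

infix 4 _≋_

_≋_ : ∀ {n} → Vector ℝ n → Vector ℝ n → Set
x ≋ y = ∀ i → x i ≈ y i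

-- The maximum-norm distance of x and y is less than δ; this metric induces
-- the Euclidean topology.
Within : ∀ {n} → ℝ → Vector ℝ n → Vector ℝ n → Set
Within δ x y = ∀ i → ∣ x i - y i ∣ < δ

Subspace : ℕ → Set₁
Subspace n = Pred (Vector ℝ n) 0ℓ

Point : ∀ {n} → Subspace n → Set
Point X = ∃ X

coords : ∀ {n} {X : Subspace n} → Point X → Vector ℝ n
coords = proj₁

IsContinuous : ∀ {m n} {X : Subspace m} {Y : Subspace n} → (Point X → Point Y) → Set
IsContinuous f = ∀ x ε → 0ℝ < ε →
  ∃[ δ ] (0ℝ < δ ×
    (∀ y → Within δ (coords x) (coords y) → Within ε (coords (f x)) (coords (f y))))

-- Continuity forces a map to respect _≋_, and in particular to be independent
-- of the membership proof carried by a point, so no separate congruence field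
-- is needed.
record C {m n} (X : Subspace m) (Y : Subspace n) : Set where
  field
    map        : Point X → Point Y
    continuous : IsContinuous map

open C public

idᶜ : ∀ {n} {X : Subspace n} → C X X
idᶜ = record { map = λ x → x ; continuous = λ _ ε 0<ε → ε , 0<ε , λ _ p → p }

constᶜ : ∀ {m n} {X : Subspace m} {Y : Subspace n} → Point Y → C X Y
constᶜ p = record
  { map        = λ _ → p
  ; continuous = λ _ ε 0<ε@(η , 0<η , N , le) → ε , 0<ε , λ _ _ i →
      η , 0<η , N , λ n N≤n →
        subst (λ r → r ℚ.+ η ℚ.≤ seq ε n)
          (sym (cong ℚ.∣_∣ (ℚ.+-inverseʳ (seq (coords p i) n)))) (le n N≤n)
  }

UnitInterval : Pred ℝ 0ℓ
UnitInterval t = 0ℝ ≤ t × t ≤ 1ℝ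

-- The cylinder [0,1] × X, as a subspace of ℝ¹⁺ⁿ.
Cylinder : ∀ {n} → Subspace n → Subspace (suc n)
Cylinder X z = UnitInterval (head z) × X (tail z)

0∈I : UnitInterval 0ℝ
0∈I = (λ ε 0<ε → 0 , λ _ _ → subst (0ℚ ℚ.≤_) (sym (ℚ.+-identityˡ ε)) (ℚ.<⇒≤ 0<ε))
    , (λ ε 0<ε → 0 , λ _ _ → ℚ.<⇒≤ (ℚ.+-mono-< (ℚ.positive⁻¹ 1ℚ) 0<ε))

1∈I : UnitInterval 1ℝ
1∈I = (λ ε 0<ε → 0 , λ _ _ → ℚ.<⇒≤ (ℚ.+-mono-< (ℚ.positive⁻¹ 1ℚ) 0<ε))
    , (λ ε 0<ε → 0 , λ _ _ → subst (ℚ._≤ 1ℚ ℚ.+ ε) (ℚ.+-identityʳ 1ℚ) (ℚ.+-monoʳ-≤ 1ℚ (ℚ.<⇒≤ 0<ε)))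

at : ∀ {n} {X : Subspace n} (t : ℝ) → UnitInterval t → Point X → Point (Cylinder X)
at t t∈I (x , x∈X) = t ∷ x , t∈I , x∈X

Homotopic : ∀ {m n} {X : Subspace m} {Y : Subspace n} → C X Y → C X Y → Set
Homotopic {X = X} {Y = Y} f g =
  Σ[ H ∈ C (Cylinder X) Y ]
    (∀ x → coords (map H (at 0ℝ 0∈I x)) ≋ coords (map f x)) ×
    (∀ x → coords (map H (at 1ℝ 1∈I x)) ≋ coords (map g x))

Contractible : ∀ {n} → Subspace n → Set
Contractible X = Σ[ p ∈ Point X ] Homotopic {X = X} {Y = X} idᶜ (constᶜ p)

------------------------------------------------------------------------
-- Finite simplicial complexes

-- The empty set counts as a simplex, and an element of Fin n need not be a
-- vertex of the complex (so that a link lives on the same ambient set).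
-- Decidability of membership expresses that the complex is a finite
-- collection of sets.
record SimplicialComplex (n : ℕ) : Set₁ where
  field
    Simplex     : Pred (Subset n) 0ℓ
    simplex?    : Decidable Simplex
    ∅-simplex   : Simplex ⊥
    face-closed : ∀ {σ τ} → τ ⊆ σ → Simplex σ → Simplex τ

open SimplicialComplex public

IsMaximal : ∀ {n} → SimplicialComplex n → Subset n → Set
IsMaximal K σ = Simplex K σ × (∀ τ → Simplex K τ → σ ⊆ τ → σ ≡ τ)

IsFaceSimplex : ∀ {n} → SimplicialComplex n → Subset n → Set
IsFaceSimplex {n} K τ =
  Σ[ σs ∈ List⁺ (Subset n) ] All (IsMaximal K) (toList σs) × τ ≡ ⋂ (toList σs)

link : ∀ {n} (K : SimplicialComplex n) (σ : Subset n) → Simplex K σ → SimplicialComplex n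
link K σ σ∈K = record
  { Simplex     = λ τ → Simplex K τ × τ ∩ σ ≡ ⊥ × Simplex K (τ ∪ σ)
  ; simplex?    = λ τ → simplex? K τ ×-dec ≡-dec Bool._≟_ (τ ∩ σ) ⊥ ×-dec simplex? K (τ ∪ σ)
  ; ∅-simplex   = ∅-simplex K , ∩-zeroˡ σ , subst (Simplex K) (sym (∪-identityˡ σ)) σ∈K
  ; face-closed = λ {τ} {ρ} ρ⊆τ (τ∈K , τ∩σ≡∅ , τ∪σ∈K) →
        face-closed K ρ⊆τ τ∈K
      , ⊆-antisym
          (λ x∈ρ∩σ → let (x∈ρ , x∈σ) = x∈p∩q⁻ ρ σ x∈ρ∩σ
                     in subst (_ ∈_) τ∩σ≡∅ (x∈p∩q⁺ (ρ⊆τ x∈ρ , x∈σ)))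
          (⊆-min (ρ ∩ σ))
      , face-closed K
          (λ x∈ρ∪σ → x∈p∪q⁺ (map₁ ρ⊆τ (x∈p∪q⁻ ρ σ x∈ρ∪σ)))
          τ∪σ∈K
  }

-- The geometric realization, in barycentric coordinates: the union over the
-- simplices τ of K of the geometric simplices spanned by the standard basis
-- vectors eᵢ with i ∈ τ.
realization : ∀ {n} → SimplicialComplex n → Subspace n
realization {n} K x =
  (∀ i → 0ℝ ≤ x i) × ∑ x ≈ 1ℝ ×
  Σ[ τ ∈ Subset n ] Simplex K τ × (∀ i → i ∉ τ → x i ≈ 0ℝ)

{-# OPTIONS --safe #-}

-- A simplex σ that is not a face simplex is strictly smaller than the
-- intersection of the maximal simplices containing it, so there is a vertex
-- v ∉ σ which can be added to every simplex containing σ. The link of σ is then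
-- a cone with apex v. It is contracted, without multiplying real numbers, by
-- truncating the barycentric coordinates at height 1 - t and giving the mass
-- that is cut off to v.

module Submission where

open import Defs
open import Data.Rational.Properties as ℚ using ()
open import Algebra.Bundles using (module CommutativeMonoid)
open import Algebra.Properties.CommutativeMonoid.Sum ℚ.+-0-commutativeMonoid
  using (sum; ∑-distrib-+)
open import Algebra.Properties.CommutativeSemigroup
  (CommutativeMonoid.commutativeSemigroup ℚ.+-0-commutativeMonoid) using (interchange)
open import Data.Fin.Base using (Fin; zero; suc)
open import Data.Fin.Properties using (any?)
open import Data.Fin.Subset using (Subset; ⊥; ⁅_⁆; _∈_; _∉_; _⊆_; _⊂_; _∩_; _∪_; ⋂)
open import Data.Fin.Subset.Induction using (⊃-wellFounded)
open import Data.Fin.Subset.Properties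
  using ( _∈?_; _⊆?_; _⊂?_; anySubset?; ∈⊤; x∈⁅x⁆; x∈⁅y⁆⇒x≡y; ⊆-antisym; ⊆-min; ⊆-trans
        ; ⊆-refl; x∈p∩q⁺; x∈p∩q⁻; x∈p∪q⁺; x∈p∪q⁻; q⊆p∪q)
open import Data.List.Base using (List; []; _∷_; tabulate)
open import Data.List.NonEmpty.Base using () renaming (_∷_ to _∷⁺_)
open import Data.List.Relation.Unary.All using (All; []; _∷_)
open import Data.List.Relation.Unary.All.Properties using (tabulate⁺; tabulate⁻)
open import Data.Nat.Base as ℕ using (ℕ; zero; suc; _⊔_)
open import Data.Nat.Properties using (m⊔n≤o⇒m≤o; m⊔n≤o⇒n≤o)
open import Data.Product.Base using (∃; ∃-syntax; _×_; _,_; proj₁; proj₂; map₂)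
open import Data.Rational.Base as ℚ using (ℚ; 0ℚ; 1ℚ; ½)
open import Data.Rational.Solver using (module +-*-Solver)
open import Data.Sum.Base using (inj₁; inj₂; [_,_]′)
open import Data.Vec.Functional using (Vector; head; tail) renaming (_∷_ to _◂_)
open import Function.Base using (_∘_)
open import Induction.WellFounded using (Acc; acc)
open import Relation.Binary.PropositionalEquality
  using (_≡_; _≢_; refl; sym; trans; cong; cong₂; subst; subst₂)
open import Relation.Nullary using (Dec; ¬_; yes; no; ¬?; contradiction)
open import Relation.Nullary.Decidable using (_×-dec_; decidable-stable)

private variable
  m n : ℕ

-- Rational estimates

halve : ∀ {ε} → 0ℚ ℚ.< ε → 0ℚ ℚ.< ½ ℚ.* ε
halve {ε} 0<ε = subst (ℚ._< ½ ℚ.* ε) (ℚ.*-zeroʳ ½) (ℚ.*-monoʳ-<-pos ½ 0<ε)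

½+½ : ∀ ε → ½ ℚ.* ε ℚ.+ ½ ℚ.* ε ≡ ε
½+½ ε = trans (sym (ℚ.*-distribʳ-+ ε ½ ½)) (ℚ.*-identityˡ ε)

½< : ∀ {ε} → 0ℚ ℚ.< ε → ½ ℚ.* ε ℚ.< ε
½< {ε} 0<ε = subst₂ ℚ._<_ (ℚ.+-identityʳ (½ ℚ.* ε)) (½+½ ε) (ℚ.+-monoʳ-< (½ ℚ.* ε) (halve 0<ε))

p≤p+ε : ∀ p {ε} → 0ℚ ℚ.< ε → p ℚ.≤ p ℚ.+ ε
p≤p+ε p {ε} 0<ε = subst (ℚ._≤ p ℚ.+ ε) (ℚ.+-identityʳ p) (ℚ.+-monoʳ-≤ p (ℚ.<⇒≤ 0<ε))

0<⊓ : ∀ {p q} → 0ℚ ℚ.< p → 0ℚ ℚ.< q → 0ℚ ℚ.< p ℚ.⊓ q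
0<⊓ {p} {q} 0<p 0<q with ℚ.⊓-sel p q
... | inj₁ e = subst (0ℚ ℚ.<_) (sym e) 0<p
... | inj₂ e = subst (0ℚ ℚ.<_) (sym e) 0<q

-- Inequalities of reals hold only eventually and up to a rational error, so the rational estimates
-- carry that error along. For sums the errors add up.
+-mono-slack : ∀ {p q r s α β} → p ℚ.≤ q ℚ.+ α → r ℚ.≤ s ℚ.+ β →
  p ℚ.+ r ℚ.≤ (q ℚ.+ s) ℚ.+ (α ℚ.+ β)
+-mono-slack {p} {q} {r} {s} {α} {β} p≤ r≤ =
  subst (p ℚ.+ r ℚ.≤_) (interchange q α s β) (ℚ.+-mono-≤ p≤ r≤)

neg-mono-slack : ∀ {p q α} → p ℚ.≤ q ℚ.+ α → ℚ.- q ℚ.≤ ℚ.- p ℚ.+ α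
neg-mono-slack {p} {q} {α} p≤ =
  subst₂ ℚ._≤_ (left p q) (right p q α) (ℚ.+-monoʳ-≤ (ℚ.- p ℚ.- q) p≤)
  where
  open +-*-Solver
  left : ∀ p q → (ℚ.- p ℚ.- q) ℚ.+ p ≡ ℚ.- q
  left = solve 2 (λ p q → (:- p :- q) :+ p := :- q) refl
  right : ∀ p q α → (ℚ.- p ℚ.- q) ℚ.+ (q ℚ.+ α) ≡ ℚ.- p ℚ.+ α
  right = solve 3 (λ p q α → (:- p :- q) :+ (q :+ α) := :- p :+ α) refl

-- A minimum is one of its two arguments, so the error does not grow as it does for sums.
⊓-glb-slack : ∀ {p q r α} → p ℚ.≤ q ℚ.+ α → p ℚ.≤ r ℚ.+ α → p ℚ.≤ (q ℚ.⊓ r) ℚ.+ α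
⊓-glb-slack {p} {q} {r} {α} p≤q p≤r with ℚ.⊓-sel q r
... | inj₁ e = subst (λ s → p ℚ.≤ s ℚ.+ α) (sym e) p≤q
... | inj₂ e = subst (λ s → p ℚ.≤ s ℚ.+ α) (sym e) p≤r

⊓-mono-slack : ∀ {p q r s α} → p ℚ.≤ q ℚ.+ α → r ℚ.≤ s ℚ.+ α → p ℚ.⊓ r ℚ.≤ (q ℚ.⊓ s) ℚ.+ α
⊓-mono-slack {p} {q} {r} {s} p≤ r≤ =
  ⊓-glb-slack {q = q} {s} (ℚ.≤-trans (ℚ.p⊓q≤p p r) p≤) (ℚ.≤-trans (ℚ.p⊓q≤q p r) r≤)

-- This is `∣ p - q ∣ ≤ ε`, split into two one-sided bounds so that each slack estimate applies to
-- each half.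
Close : ℚ → ℚ → ℚ → Set
Close ε p q = p ℚ.≤ q ℚ.+ ε × q ℚ.≤ p ℚ.+ ε

close-mono : ∀ {α β p q} → α ℚ.≤ β → Close α p q → Close β p q
close-mono {p = p} {q} α≤β (p≤ , q≤) =
  ℚ.≤-trans p≤ (ℚ.+-monoʳ-≤ q α≤β) , ℚ.≤-trans q≤ (ℚ.+-monoʳ-≤ p α≤β)

close-+ : ∀ {α β p q r s} → Close α p q → Close β r s → Close (α ℚ.+ β) (p ℚ.+ r) (q ℚ.+ s)
close-+ {p = p} {q} {r} {s} (p≤ , q≤) (r≤ , s≤) =
  +-mono-slack {p} {q} {r} {s} p≤ r≤ , +-mono-slack {q} {p} {s} {r} q≤ s≤

close-⊓ : ∀ {ε p q r s} → Close ε p q → Close ε r s → Close ε (p ℚ.⊓ r) (q ℚ.⊓ s)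
close-⊓ {_} {p} {q} {r} {s} (p≤ , q≤) (r≤ , s≤) =
  ⊓-mono-slack {p} {q} {r} {s} p≤ r≤ , ⊓-mono-slack {q} {p} {s} {r} q≤ s≤

p≤∣p∣ : ∀ p → p ℚ.≤ ℚ.∣ p ∣
p≤∣p∣ p with ℚ.≤-total 0ℚ p
... | inj₁ 0≤p = ℚ.≤-reflexive (sym (ℚ.0≤p⇒∣p∣≡p 0≤p))
... | inj₂ p≤0 = ℚ.≤-trans p≤0 (ℚ.0≤∣p∣ p)

-[p-q]≡q-p : ∀ p q → ℚ.- (p ℚ.- q) ≡ q ℚ.- p
-[p-q]≡q-p = solve 2 (λ p q → :- (p :- q) := q :- p) refl
  where open +-*-Solver

p≤q+r⇒p-q≤r : ∀ {p q r} → p ℚ.≤ q ℚ.+ r → p ℚ.- q ℚ.≤ r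
p≤q+r⇒p-q≤r {p} {q} {r} p≤ = subst (p ℚ.- q ℚ.≤_) (cancel q r) (ℚ.+-monoˡ-≤ (ℚ.- q) p≤)
  where
  open +-*-Solver
  cancel : ∀ q r → (q ℚ.+ r) ℚ.- q ≡ r
  cancel = solve 2 (λ q r → (q :+ r) :- q := r) refl

dist⇒close : ∀ {ε p q} → ℚ.∣ p ℚ.- q ∣ ℚ.≤ ε → Close ε p q
dist⇒close {ε} {p} {q} d≤ =
  one-sided p q d≤ , one-sided q p (subst (ℚ._≤ ε)
    (trans (sym (ℚ.∣-p∣≡∣p∣ (p ℚ.- q))) (cong ℚ.∣_∣ (-[p-q]≡q-p p q))) d≤)
  where
  open +-*-Solver
  split : ∀ p q → q ℚ.+ (p ℚ.- q) ≡ p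
  split = solve 2 (λ p q → q :+ (p :- q) := p) refl
  one-sided : ∀ p q → ℚ.∣ p ℚ.- q ∣ ℚ.≤ ε → p ℚ.≤ q ℚ.+ ε
  one-sided p q d≤ = subst (ℚ._≤ q ℚ.+ ε) (split p q)
    (ℚ.+-monoʳ-≤ q (ℚ.≤-trans (p≤∣p∣ (p ℚ.- q)) d≤))

close⇒dist : ∀ {ε p q} → Close ε p q → ℚ.∣ p ℚ.- q ∣ ℚ.≤ ε
close⇒dist {ε} {p} {q} (p≤ , q≤) with ℚ.∣p∣≡p∨∣p∣≡-p (p ℚ.- q)
... | inj₁ e = subst (ℚ._≤ ε) (sym e) (p≤q+r⇒p-q≤r p≤)
... | inj₂ e = subst (ℚ._≤ ε) (sym (trans e (-[p-q]≡q-p p q))) (p≤q+r⇒p-q≤r q≤)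

-- Order properties of the reals

Eventually : (ℕ → Set) → Set
Eventually P = ∃[ N ] (∀ k → N ℕ.≤ k → P k)

eventually₂ : ∀ {P Q R : ℕ → Set} → (∀ {k} → P k → Q k → R k) →
  Eventually P → Eventually Q → Eventually R
eventually₂ f (M , p) (N , q) =
  M ⊔ N , λ k ≤k → f (p k (m⊔n≤o⇒m≤o M N ≤k)) (q k (m⊔n≤o⇒n≤o M N ≤k))

eventually-all : ∀ {n} {P : Fin n → ℕ → Set} →
  (∀ i → Eventually (P i)) → Eventually (λ k → ∀ i → P i k)
eventually-all {zero}  _ = 0 , λ _ _ ()
eventually-all {suc n} p =
  eventually₂ (λ { p₀ pₛ zero → p₀ ; p₀ pₛ (suc i) → pₛ i }) (p zero) (eventually-all (p ∘ suc))

pointwise⇒≤ : ∀ {x y} → (∀ k → seq x k ℚ.≤ seq y k) → x ≤ y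
pointwise⇒≤ {y = y} x≤y ε 0<ε = 0 , λ k _ → ℚ.≤-trans (x≤y k) (p≤p+ε (seq y k) 0<ε)

≤-refl : ∀ {x} → x ≤ x
≤-refl {x} = pointwise⇒≤ {x} {x} λ _ → ℚ.≤-refl

≤-trans : ∀ {x y z} → x ≤ y → y ≤ z → x ≤ z
≤-trans {x} {y} {z} x≤y y≤z ε 0<ε =
  eventually₂
    (λ {k} p q → ℚ.≤-trans p (subst (seq y k ℚ.+ ½ ℚ.* ε ℚ.≤_) (regroup (seq z k))
                   (ℚ.+-monoˡ-≤ (½ ℚ.* ε) q)))
    (x≤y (½ ℚ.* ε) (halve 0<ε)) (y≤z (½ ℚ.* ε) (halve 0<ε))
  where
  regroup : ∀ r → (r ℚ.+ ½ ℚ.* ε) ℚ.+ ½ ℚ.* ε ≡ r ℚ.+ ε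
  regroup r = trans (ℚ.+-assoc r _ _) (cong (r ℚ.+_) (½+½ ε))

≤-antisym : ∀ {x y} → x ≤ y → y ≤ x → x ≈ y
≤-antisym x≤y y≤x ε 0<ε =
  -- The order yields a non-strict bound while `_≈_` asks for a strict one, hence half of `ε`.
  eventually₂ (λ p q → ℚ.≤-<-trans (close⇒dist (p , q)) (½< 0<ε))
    (x≤y (½ ℚ.* ε) (halve 0<ε)) (y≤x (½ ℚ.* ε) (halve 0<ε))

≈⇒≤ : ∀ {x y} → x ≈ y → x ≤ y
≈⇒≤ {x} {y} x≈y ε 0<ε =
  map₂ (λ p k ≤k → proj₁ (dist⇒close {ε} {seq x k} {seq y k} (ℚ.<⇒≤ (p k ≤k)))) (x≈y ε 0<ε)

≈⇒≥ : ∀ {x y} → x ≈ y → y ≤ x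
≈⇒≥ {x} {y} x≈y ε 0<ε =
  map₂ (λ p k ≤k → proj₂ (dist⇒close {ε} {seq x k} {seq y k} (ℚ.<⇒≤ (p k ≤k)))) (x≈y ε 0<ε)

≈-sym : ∀ {x y} → x ≈ y → y ≈ x
≈-sym {x} {y} x≈y = ≤-antisym {y} {x} (≈⇒≥ {x} {y} x≈y) (≈⇒≤ {x} {y} x≈y)

≈-trans : ∀ {x y z} → x ≈ y → y ≈ z → x ≈ z
≈-trans {x} {y} {z} x≈y y≈z = ≤-antisym {x} {z}
  (≤-trans {x} {y} {z} (≈⇒≤ {x} {y} x≈y) (≈⇒≤ {y} {z} y≈z))
  (≤-trans {z} {y} {x} (≈⇒≥ {y} {z} y≈z) (≈⇒≥ {x} {y} x≈y))

pointwise⇒≈ : ∀ {x y} → (∀ k → seq x k ≡ seq y k) → x ≈ y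
pointwise⇒≈ {x} {y} x≡y = ≤-antisym {x} {y}
  (pointwise⇒≤ {x} {y} λ k → ℚ.≤-reflexive (x≡y k))
  (pointwise⇒≤ {y} {x} λ k → ℚ.≤-reflexive (sym (x≡y k)))

+-mono-≤ : ∀ {x y z w} → x ≤ y → z ≤ w → x + z ≤ y + w
+-mono-≤ {x} {y} {z} {w} x≤y z≤w ε 0<ε =
  eventually₂ (λ {k} p q → subst (λ η → seq x k ℚ.+ seq z k ℚ.≤ (seq y k ℚ.+ seq w k) ℚ.+ η) (½+½ ε)
                 (+-mono-slack {seq x k} {seq y k} {seq z k} {seq w k} p q))
    (x≤y (½ ℚ.* ε) (halve 0<ε)) (z≤w (½ ℚ.* ε) (halve 0<ε))

neg-antimono-≤ : ∀ {x y} → x ≤ y → - y ≤ - x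
neg-antimono-≤ x≤y ε 0<ε = map₂ (λ p k ≤k → neg-mono-slack (p k ≤k)) (x≤y ε 0<ε)

-- Binary minimum of reals

infixl 7 _⊓_

-- The minimum does not increase the larger of the two distances, so it preserves Cauchy sequences;
-- the halving only secures strictness.
_⊓_ : ℝ → ℝ → ℝ
x ⊓ y = mkℝ (λ k → seq x k ℚ.⊓ seq y k) λ ε 0<ε →
  let (M , xM) = cauchy x (½ ℚ.* ε) (halve 0<ε)
      (N , yN) = cauchy y (½ ℚ.* ε) (halve 0<ε)
  in M ⊔ N , λ j k ≤j ≤k → ℚ.≤-<-trans
       (close⇒dist (close-⊓ {½ ℚ.* ε} {seq x j} {seq x k} {seq y j} {seq y k}
         (dist⇒close (ℚ.<⇒≤ (xM j k (m⊔n≤o⇒m≤o M N ≤j) (m⊔n≤o⇒m≤o M N ≤k))))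
         (dist⇒close (ℚ.<⇒≤ (yN j k (m⊔n≤o⇒n≤o M N ≤j) (m⊔n≤o⇒n≤o M N ≤k))))))
       (½< 0<ε)

x⊓y≤x : ∀ x y → x ⊓ y ≤ x
x⊓y≤x x y = pointwise⇒≤ {x ⊓ y} {x} λ k → ℚ.p⊓q≤p (seq x k) (seq y k)

x⊓y≤y : ∀ x y → x ⊓ y ≤ y
x⊓y≤y x y = pointwise⇒≤ {x ⊓ y} {y} λ k → ℚ.p⊓q≤q (seq x k) (seq y k)

⊓-glb : ∀ {x y z} → x ≤ y → x ≤ z → x ≤ y ⊓ z
⊓-glb {_} {y} {z} x≤y x≤z ε 0<ε =
  eventually₂ (λ {k} → ⊓-glb-slack {q = seq y k} {seq z k}) (x≤y ε 0<ε) (x≤z ε 0<ε)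

x≤y⇒x⊓y≈x : ∀ {x y} → x ≤ y → x ⊓ y ≈ x
x≤y⇒x⊓y≈x {x} {y} x≤y = ≤-antisym {x ⊓ y} {x} (x⊓y≤x x y) (⊓-glb {x} {x} {y} (≤-refl {x}) x≤y)

0≤1-x : ∀ {x} → x ≤ 1ℝ → 0ℝ ≤ 1ℝ - x
0≤1-x {x} x≤1 = ≤-trans {0ℝ} {1ℝ - 1ℝ} {1ℝ - x}
  (pointwise⇒≤ {0ℝ} {1ℝ - 1ℝ} λ _ → ℚ.≤-refl)
  (+-mono-≤ {1ℝ} {1ℝ} { - 1ℝ} { - x} (≤-refl {1ℝ}) (neg-antimono-≤ {x} {1ℝ} x≤1))

-- Finite sums of reals

∑-mono-≤ : ∀ {n} (x y : Vector ℝ n) → (∀ i → x i ≤ y i) → ∑ x ≤ ∑ y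
∑-mono-≤ {zero}  x y _   = ≤-refl {0ℝ}
∑-mono-≤ {suc n} x y x≤y = +-mono-≤ {x zero} {y zero} {∑ (tail x)} {∑ (tail y)}
  (x≤y zero) (∑-mono-≤ (tail x) (tail y) (x≤y ∘ suc))

∑-cong : ∀ {n} (x y : Vector ℝ n) → x ≋ y → ∑ x ≈ ∑ y
∑-cong x y x≋y = ≤-antisym {∑ x} {∑ y}
  (∑-mono-≤ x y λ i → ≈⇒≤ {x i} {y i} (x≋y i)) (∑-mono-≤ y x λ i → ≈⇒≥ {x i} {y i} (x≋y i))

0≤∑ : ∀ {n} (x : Vector ℝ n) → (∀ i → 0ℝ ≤ x i) → 0ℝ ≤ ∑ x
0≤∑ {zero}  x _   = ≤-refl {0ℝ}
0≤∑ {suc n} x 0≤x = +-mono-≤ {0ℝ} {x zero} {0ℝ} {∑ (tail x)} (0≤x zero) (0≤∑ (tail x) (0≤x ∘ suc))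

-- Serves to bound every barycentric coordinate by 1, so that truncation at height 1 changes
-- nothing.
xᵢ≤∑x : ∀ {n} (x : Vector ℝ n) → (∀ i → 0ℝ ≤ x i) → ∀ i → x i ≤ ∑ x
xᵢ≤∑x x 0≤x zero = ≤-trans {x zero} {x zero + 0ℝ} {∑ x}
  (pointwise⇒≤ {x zero} {x zero + 0ℝ} λ k → ℚ.≤-reflexive (sym (ℚ.+-identityʳ (seq (x zero) k))))
  (+-mono-≤ {x zero} {x zero} {0ℝ} {∑ (tail x)} (≤-refl {x zero}) (0≤∑ (tail x) (0≤x ∘ suc)))
xᵢ≤∑x x 0≤x (suc i) = ≤-trans {x (suc i)} {0ℝ + ∑ (tail x)} {∑ x}
  (≤-trans {x (suc i)} {∑ (tail x)} {0ℝ + ∑ (tail x)} (xᵢ≤∑x (tail x) (0≤x ∘ suc) i)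
    (pointwise⇒≤ {∑ (tail x)} {0ℝ + ∑ (tail x)} λ k →
      ℚ.≤-reflexive (sym (ℚ.+-identityˡ (seq (∑ (tail x)) k)))))
  (+-mono-≤ {0ℝ} {x zero} {∑ (tail x)} {∑ (tail x)} (0≤x zero) (≤-refl {∑ (tail x)}))

-- Completing a subprobability vector at a vertex

-- The multiple of the basis vector at `v` by `c`. Recursion on the vertex, instead of a test for
-- equality of indices, makes its sum and its continuity provable by the same recursion.
spike : Fin n → ℝ → Vector ℝ n
spike zero    c = c ◂ λ _ → 0ℝ
spike (suc v) c = 0ℝ ◂ spike v c

spike-rel : (R : ℝ → ℝ → Set) → R 0ℝ 0ℝ → ∀ (v : Fin n) {c d} → R c d →
  ∀ i → R (spike v c i) (spike v d i)
spike-rel R r₀ zero    r zero    = r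
spike-rel R r₀ zero    r (suc i) = r₀
spike-rel R r₀ (suc v) r zero    = r₀
spike-rel R r₀ (suc v) r (suc i) = spike-rel R r₀ v r i

spike-off : ∀ (v : Fin n) c i → i ≢ v → spike v c i ≡ 0ℝ
spike-off zero    c zero    i≢v = contradiction refl i≢v
spike-off zero    c (suc i) i≢v = refl
spike-off (suc v) c zero    i≢v = refl
spike-off (suc v) c (suc i) i≢v = spike-off v c i (i≢v ∘ cong suc)

∑-0 : ∀ n k → seq (∑ {n} (λ _ → 0ℝ)) k ≡ 0ℚ
∑-0 zero    k = refl
∑-0 (suc n) k = trans (ℚ.+-identityˡ _) (∑-0 n k)

∑-spike : ∀ (v : Fin n) c k → seq (∑ (spike v c)) k ≡ seq c k
∑-spike {suc n} zero    c k = trans (cong (seq c k ℚ.+_) (∑-0 n k)) (ℚ.+-identityʳ (seq c k))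
∑-spike         (suc v) c k = trans (ℚ.+-identityˡ _) (∑-spike v c k)

-- Addition of reals is termwise, so additivity of `∑` reduces to additivity of rational sums at
-- each stage.
seq-∑ : ∀ {n} (x : Vector ℝ n) k → seq (∑ x) k ≡ sum (λ i → seq (x i) k)
seq-∑ {zero}  x k = refl
seq-∑ {suc n} x k = cong (seq (x zero) k ℚ.+_) (seq-∑ (tail x) k)

∑-+ : ∀ {n} (x y : Vector ℝ n) k →
  seq (∑ (λ i → x i + y i)) k ≡ seq (∑ x) k ℚ.+ seq (∑ y) k
∑-+ x y k = trans (seq-∑ (λ i → x i + y i) k)
  (trans (∑-distrib-+ (λ i → seq (x i) k) (λ i → seq (y i) k))
    (sym (cong₂ ℚ._+_ (seq-∑ x k) (seq-∑ y k))))

-- The mass missing from 1 is placed at `v`. The zero vector thus becomes the vertex `v`.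
complete : Fin n → Vector ℝ n → Vector ℝ n
complete v y i = y i + spike v (1ℝ - ∑ y) i

complete-nonneg : ∀ (v : Fin n) y → (∀ i → 0ℝ ≤ y i) → ∑ y ≤ 1ℝ → ∀ i → 0ℝ ≤ complete v y i
complete-nonneg v y 0≤y ∑y≤1 i = +-mono-≤ {0ℝ} {y i} {0ℝ} {spike v (1ℝ - ∑ y) i} (0≤y i)
  -- The relation ignores its second argument, so `d` is a mere placeholder.
  (spike-rel (λ c _ → 0ℝ ≤ c) (≤-refl {0ℝ}) v {d = 0ℝ} (0≤1-x {∑ y} ∑y≤1) i)

∑-complete : ∀ (v : Fin n) y → ∑ (complete v y) ≈ 1ℝ
∑-complete v y = pointwise⇒≈ {∑ (complete v y)} {1ℝ} λ k →
  trans (∑-+ y (spike v (1ℝ - ∑ y)) k)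
    (trans (cong (seq (∑ y) k ℚ.+_) (∑-spike v (1ℝ - ∑ y) k)) (cancel (seq (∑ y) k)))
  where
  open +-*-Solver
  cancel : ∀ p → p ℚ.+ (1ℚ ℚ.- p) ≡ 1ℚ
  cancel = solve 1 (λ p → p :+ (con 1ℚ :- p) := con 1ℚ) refl

complete-off : ∀ (v : Fin n) y i → i ≢ v → complete v y i ≈ y i
complete-off v y i i≢v = pointwise⇒≈ {complete v y i} {y i} λ k →
  trans (cong (λ c → seq (y i + c) k) (spike-off v (1ℝ - ∑ y) i i≢v)) (ℚ.+-identityʳ (seq (y i) k))

complete-cong : ∀ (v : Fin n) x y → x ≋ y → complete v x ≋ complete v y
complete-cong v x y x≋y i = ≤-antisym {complete v x i} {complete v y i}
  (half x y x≋y i) (half y x (λ j → ≈-sym {x j} {y j} (x≋y j)) i)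
  where
  -- Completion is not monotone: the missing mass falls as the sum grows. Each inequality therefore
  -- uses both halves of `x ≋ y`.
  half : ∀ x y → x ≋ y → ∀ i → complete v x i ≤ complete v y i
  half x y x≋y i =
    +-mono-≤ {x i} {y i} {spike v (1ℝ - ∑ x) i} {spike v (1ℝ - ∑ y) i} (≈⇒≤ {x i} {y i} (x≋y i))
      (spike-rel _≤_ (≤-refl {0ℝ}) v
        (+-mono-≤ {1ℝ} {1ℝ} { - ∑ x} { - ∑ y} (≤-refl {1ℝ})
          (neg-antimono-≤ {∑ y} {∑ x} (≈⇒≥ {∑ x} {∑ y} (∑-cong x y x≋y)))) i)

-- A vector of total mass 1 misses no mass, so the added spike has height 0.
complete-id : ∀ (v : Fin n) x → ∑ x ≈ 1ℝ → complete v x ≋ x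
complete-id v x ∑x≈1 i = ≤-antisym {complete v x i} {x i}
  (≤-trans {complete v x i} {x i + 0ℝ} {x i}
    (+-mono-≤ {x i} {x i} {spike v (1ℝ - ∑ x) i} {0ℝ} (≤-refl {x i})
      (spike-rel (λ c _ → c ≤ 0ℝ) (≤-refl {0ℝ}) v {d = 0ℝ}
        (+-mono-≤ {1ℝ} {1ℝ} { - ∑ x} { - 1ℝ} (≤-refl {1ℝ})
          (neg-antimono-≤ {1ℝ} {∑ x} (≈⇒≥ {∑ x} {1ℝ} ∑x≈1))) i))
    (pointwise⇒≤ {x i + 0ℝ} {x i} λ k → ℚ.≤-reflexive (ℚ.+-identityʳ (seq (x i) k))))
  (≤-trans {x i} {x i + 0ℝ} {complete v x i}
    (pointwise⇒≤ {x i} {x i + 0ℝ} λ k → ℚ.≤-reflexive (sym (ℚ.+-identityʳ (seq (x i) k))))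
    (+-mono-≤ {x i} {x i} {0ℝ} {spike v (1ℝ - ∑ x) i} (≤-refl {x i})
      (spike-rel (λ c _ → 0ℝ ≤ c) (≤-refl {0ℝ}) v {d = 0ℝ}
        (0≤1-x {∑ x} (≈⇒≤ {∑ x} {1ℝ} ∑x≈1)) i)))

-- Uniformly continuous functions

-- The modulus δ serves all approximation stages k at once.
UniformlyContinuous : (Vector ℝ m → ℝ) → Set
UniformlyContinuous F = ∀ ε → 0ℚ ℚ.< ε → ∃[ δ ] (0ℚ ℚ.< δ ×
  (∀ x y k → (∀ i → Close δ (seq (x i) k) (seq (y i) k)) → Close ε (seq (F x) k) (seq (F y) k)))

uc-proj : ∀ (i : Fin m) → UniformlyContinuous (λ x → x i)
uc-proj i ε 0<ε = ε , 0<ε , λ _ _ _ c → c i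

uc-const : ∀ c → UniformlyContinuous {m} (λ _ → c)
uc-const c ε 0<ε = ε , 0<ε , λ _ _ k _ → p≤p+ε (seq c k) 0<ε , p≤p+ε (seq c k) 0<ε

module _ {F G : Vector ℝ m → ℝ} where

  uc-+ : UniformlyContinuous F → UniformlyContinuous G → UniformlyContinuous (λ x → F x + G x)
  uc-+ ucF ucG ε 0<ε =
    let (α , 0<α , f) = ucF (½ ℚ.* ε) (halve 0<ε)
        (β , 0<β , g) = ucG (½ ℚ.* ε) (halve 0<ε)
    in α ℚ.⊓ β , 0<⊓ 0<α 0<β , λ x y k c →
         subst (λ η → Close η (seq (F x + G x) k) (seq (F y + G y) k)) (½+½ ε)
           (close-+ {p = seq (F x) k} {seq (F y) k} {seq (G x) k} {seq (G y) k}
             (f x y k λ i → close-mono (ℚ.p⊓q≤p α β) (c i))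
             (g x y k λ i → close-mono (ℚ.p⊓q≤q α β) (c i)))

  uc-⊓ : UniformlyContinuous F → UniformlyContinuous G → UniformlyContinuous (λ x → F x ⊓ G x)
  uc-⊓ ucF ucG ε 0<ε =
    let (α , 0<α , f) = ucF ε 0<ε
        (β , 0<β , g) = ucG ε 0<ε
    in α ℚ.⊓ β , 0<⊓ 0<α 0<β , λ x y k c → close-⊓
         (f x y k λ i → close-mono (ℚ.p⊓q≤p α β) (c i))
         (g x y k λ i → close-mono (ℚ.p⊓q≤q α β) (c i))

uc-neg : ∀ {F : Vector ℝ m → ℝ} → UniformlyContinuous F → UniformlyContinuous (λ x → - F x)
uc-neg ucF ε 0<ε =
  let (δ , 0<δ , f) = ucF ε 0<ε
  in δ , 0<δ , λ x y k c →
       let (f₁ , f₂) = f x y k c in neg-mono-slack f₂ , neg-mono-slack f₁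

uc-∑ : ∀ {n} {F : Vector ℝ m → Vector ℝ n} → (∀ i → UniformlyContinuous (λ x → F x i)) →
  UniformlyContinuous (λ x → ∑ (F x))
uc-∑ {n = zero}      _  = uc-const 0ℝ
uc-∑ {n = suc n} {F} uc =
  uc-+ {F = λ x → head (F x)} {G = λ x → ∑ (tail (F x))} (uc zero) (uc-∑ {F = tail ∘ F} (uc ∘ suc))

uc-spike : ∀ {F : Vector ℝ m → ℝ} → UniformlyContinuous F →
  ∀ (v i : Fin n) → UniformlyContinuous (λ x → spike v (F x) i)
uc-spike uc zero    zero    = uc
uc-spike uc zero    (suc i) = uc-const 0ℝ
uc-spike uc (suc v) zero    = uc-const 0ℝ
uc-spike uc (suc v) (suc i) = uc-spike uc v i

uc-complete : ∀ {F : Vector ℝ m → Vector ℝ n} → (∀ i → UniformlyContinuous (λ x → F x i)) →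
  ∀ (v i : Fin n) → UniformlyContinuous (λ x → complete v (F x) i)
uc-complete {F = F} uc v i = uc-+ {F = λ x → F x i} {G = λ x → spike v (1ℝ - ∑ (F x)) i} (uc i)
  (uc-spike {F = λ x → 1ℝ - ∑ (F x)}
    (uc-+ {F = λ _ → 1ℝ} {G = λ x → - ∑ (F x)} (uc-const 1ℝ)
      (uc-neg {F = λ x → ∑ (F x)} (uc-∑ {F = F} uc))) v i)

-- The minimum of finitely many bounds works for all indices, since `P` passes to smaller values; 1
-- is an arbitrary choice for the empty family.
common-bound : ∀ {n} {P : Fin n → ℚ → Set} → (∀ i {α β} → α ℚ.≤ β → P i β → P i α) →
  (∀ i → ∃[ δ ] (0ℚ ℚ.< δ × P i δ)) → ∃[ δ ] (0ℚ ℚ.< δ × ∀ i → P i δ)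
common-bound {zero}  _    _ = 1ℚ , ℚ.positive⁻¹ 1ℚ , λ ()
common-bound {suc n} down p =
  let (α , 0<α , pα) = p zero
      (β , 0<β , pβ) = common-bound (down ∘ suc) (p ∘ suc)
  in α ℚ.⊓ β , 0<⊓ 0<α 0<β ,
     λ { zero    → down zero (ℚ.p⊓q≤p α β) pα
       ; (suc i) → down (suc i) (ℚ.p⊓q≤q α β) (pβ i) }

-- Nearby points have all their finitely many coordinates `δ`-close from a common stage on, and a
-- modulus valid at every stage then applies to each later stage.
uc⇒continuous : ∀ {X : Subspace m} {Y : Subspace n} (F : Vector ℝ m → Vector ℝ n)
  (F∈ : ∀ x → X x → Y (F x)) → (∀ i → UniformlyContinuous (λ x → F x i)) →
  IsContinuous {X = X} {Y = Y} (λ (x , x∈X) → F x , F∈ x x∈X)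
uc⇒continuous F F∈ uc (x , _) ε (η , 0<η , N , η≤ε) =
  let (δ , 0<δ , f) = common-bound
        (λ i α≤β g x y k c → g x y k λ j → close-mono α≤β (c j))
        (λ i → uc i (½ ℚ.* η) (halve 0<η))
  in fromℚ δ
   , (δ , 0<δ , 0 , λ _ _ → ℚ.≤-reflexive (ℚ.+-identityˡ δ))
   -- Eventually `η` is at most `ε`. Half of `η` bounds the distance of the images, and the other
   -- half is the gap that strict inequality of reals requires.
   , λ (y , _) xy i → ½ ℚ.* η , halve 0<η ,
       eventually₂
         (λ {k} c η≤εₖ → ℚ.≤-trans (ℚ.+-monoˡ-≤ (½ ℚ.* η) (close⇒dist (f i x y k c)))
           (subst (ℚ._≤ seq ε k) (trans (ℚ.+-identityˡ η) (sym (½+½ η))) η≤εₖ))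
         (eventually-all λ j →
           let (ζ , 0<ζ , M , d) = xy j
           in M , λ k M≤k → dist⇒close (ℚ.≤-trans (p≤p+ε _ 0<ζ) (d k M≤k)))
         (N , η≤ε)

-- Cones are contractible

module _ (L : SimplicialComplex n) (v : Fin n)
         (apex : ∀ τ → Simplex L τ → Simplex L (τ ∪ ⁅ v ⁆)) where

  -- Completion enlarges the support by at most `v`, and `apex` keeps the enlarged simplex in `L`.
  complete∈ : ∀ y → (∀ i → 0ℝ ≤ y i) → ∑ y ≤ 1ℝ →
    ∀ τ → Simplex L τ → (∀ i → i ∉ τ → y i ≈ 0ℝ) → realization L (complete v y)
  complete∈ y 0≤y ∑y≤1 τ τ∈L supp =
      complete-nonneg v y 0≤y ∑y≤1
    , ∑-complete v y
    , τ ∪ ⁅ v ⁆ , apex τ τ∈L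
    , λ i i∉ → ≈-trans {complete v y i} {y i} {0ℝ}
        (complete-off v y i λ i≡v → i∉ (x∈p∪q⁺ (inj₂ (subst (_∈ ⁅ v ⁆) (sym i≡v) (x∈⁅x⁆ v)))))
        (supp i (i∉ ∘ x∈p∪q⁺ ∘ inj₁))

  -- Here `head z` is the time and `tail z` the point being moved.
  truncate : Vector ℝ (suc n) → Vector ℝ n
  truncate z i = tail z i ⊓ (1ℝ - head z)

  truncate∈ : ∀ z → Cylinder (realization L) z → realization L (complete v (truncate z))
  truncate∈ z ((0≤t , t≤1) , 0≤x , ∑x≈1 , τ , τ∈L , supp) =
    complete∈ (truncate z) 0≤y
      (≤-trans {∑ (truncate z)} {∑ (tail z)} {1ℝ}
        (∑-mono-≤ (truncate z) (tail z) λ i → x⊓y≤x (tail z i) s)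
        (≈⇒≤ {∑ (tail z)} {1ℝ} ∑x≈1))
      -- Coordinates that vanish stay zero under truncation, so the same `τ` carries the truncated
      -- vector.
      τ τ∈L λ i i∉τ → ≤-antisym {truncate z i} {0ℝ}
        (≤-trans {truncate z i} {tail z i} {0ℝ} (x⊓y≤x (tail z i) s) (≈⇒≤ {tail z i} {0ℝ} (supp i i∉τ)))
        (0≤y i)
    where
    s = 1ℝ - head z
    0≤y : ∀ i → 0ℝ ≤ truncate z i
    0≤y i = ⊓-glb {0ℝ} {tail z i} {s} (0≤x i) (0≤1-x {head z} t≤1)

  truncate-0 : ∀ x → realization L x → truncate (0ℝ ◂ x) ≋ x
  truncate-0 x (0≤x , ∑x≈1 , _) i = x≤y⇒x⊓y≈x {x i} {1ℝ - 0ℝ}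
    (≤-trans {x i} {∑ x} {1ℝ - 0ℝ} (xᵢ≤∑x x 0≤x i)
      (≤-trans {∑ x} {1ℝ} {1ℝ - 0ℝ} (≈⇒≤ {∑ x} {1ℝ} ∑x≈1)
        (pointwise⇒≤ {1ℝ} {1ℝ - 0ℝ} λ _ → ℚ.≤-refl)))

  truncate-1 : ∀ x → (∀ i → 0ℝ ≤ x i) → truncate (1ℝ ◂ x) ≋ (λ _ → 0ℝ)
  truncate-1 x 0≤x i = ≤-antisym {x i ⊓ (1ℝ - 1ℝ)} {0ℝ}
    (x⊓y≤y (x i) (1ℝ - 1ℝ))
    (⊓-glb {0ℝ} {x i} {1ℝ - 1ℝ} (0≤x i) (≤-refl {0ℝ}))

  cone-contractible : Contractible (realization L)
  cone-contractible =
      ( complete v (λ _ → 0ℝ)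
      , complete∈ (λ _ → 0ℝ) (λ _ → ≤-refl {0ℝ})
          (≤-trans {∑ {n} (λ _ → 0ℝ)} {0ℝ} {1ℝ}
            (pointwise⇒≤ {∑ {n} (λ _ → 0ℝ)} {0ℝ} λ k → ℚ.≤-reflexive (∑-0 n k)) (proj₂ 0∈I))
          -- The zero vector is carried by the empty simplex, so the contraction ends at the apex
          -- itself.
          ⊥ (∅-simplex L) λ _ _ → pointwise⇒≈ {0ℝ} {0ℝ} λ _ → refl )
    , record
        { map        = λ (z , z∈) → complete v (truncate z) , truncate∈ z z∈
        ; continuous = uc⇒continuous {X = Cylinder (realization L)} {Y = realization L}
            (λ z → complete v (truncate z)) truncate∈
            (uc-complete {F = truncate} (λ i →
              uc-⊓ {F = λ z → z (suc i)} {G = λ z → 1ℝ - z zero} (uc-proj (suc i))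
                (uc-+ {F = λ _ → 1ℝ} {G = λ z → - z zero} (uc-const 1ℝ)
                  (uc-neg {F = λ z → z zero} (uc-proj zero)))) v)
        }
    , (λ (x , x∈) i → ≈-trans {complete v (truncate (0ℝ ◂ x)) i} {complete v x i} {x i}
        (complete-cong v (truncate (0ℝ ◂ x)) x (truncate-0 x x∈) i)
        (complete-id v x (proj₁ (proj₂ x∈)) i))
    , (λ (x , x∈) → complete-cong v (truncate (1ℝ ◂ x)) (λ _ → 0ℝ) (truncate-1 x (proj₁ x∈)))

-- Links of simplices that are not face simplices

∈⋂⁺ : ∀ {x : Fin n} (ps : List (Subset n)) → All (x ∈_) ps → x ∈ ⋂ ps
∈⋂⁺ []       []          = ∈⊤
∈⋂⁺ (p ∷ ps) (x∈p ∷ x∈ps) = x∈p∩q⁺ (x∈p , ∈⋂⁺ ps x∈ps)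

∈⋂⁻ : ∀ {x : Fin n} (ps : List (Subset n)) → x ∈ ⋂ ps → All (x ∈_) ps
∈⋂⁻ []       _  = []
∈⋂⁻ (p ∷ ps) x∈ = let (x∈p , x∈ps) = x∈p∩q⁻ p (⋂ ps) x∈ in x∈p ∷ ∈⋂⁻ ps x∈ps

module _ (K : SimplicialComplex n) where

  -- Strict enlargement of subsets of a finite set terminates, and a larger simplex can be searched
  -- for because `Simplex` is decidable.
  maximal-above : ∀ ρ → Simplex K ρ → ∃[ τ ] (IsMaximal K τ × ρ ⊆ τ)
  maximal-above ρ = go ρ (⊃-wellFounded ρ)
    where
    go : ∀ ρ → Acc (λ p q → q ⊂ p) ρ → Simplex K ρ → ∃[ τ ] (IsMaximal K τ × ρ ⊆ τ)
    go ρ (acc rec) ρ∈K with anySubset? (λ τ → simplex? K τ ×-dec ρ ⊂? τ)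
    ... | yes (τ , τ∈K , ρ⊂τ) =
      let (μ , μ-max , τ⊆μ) = go τ (rec ρ⊂τ) τ∈K in μ , μ-max , ⊆-trans (proj₁ ρ⊂τ) τ⊆μ
    ... | no none = ρ , (ρ∈K , λ τ τ∈K ρ⊆τ → ⊆-antisym ρ⊆τ λ {x} x∈τ →
            decidable-stable (x ∈? ρ) λ x∉ρ → none (τ , τ∈K , ρ⊆τ , x , x∈τ , x∉ρ))
          , ⊆-refl

  -- A witness that `v` cannot be added to every simplex containing `σ`. For a simplex `σ`, no
  -- witness exists exactly when `v` lies in all maximal simplices above `σ`.
  Blocks : Subset n → Fin n → Subset n → Set
  Blocks σ v ρ = Simplex K ρ × σ ⊆ ρ × ¬ Simplex K (ρ ∪ ⁅ v ⁆)

  blocking? : ∀ σ v → Dec (∃ (Blocks σ v))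
  blocking? σ v = anySubset? λ ρ → simplex? K ρ ×-dec σ ⊆? ρ ×-dec ¬? (simplex? K (ρ ∪ ⁅ v ⁆))

  -- A maximal simplex above a blocking `ρ` contains `σ` but not `v`, since otherwise `ρ ∪ ⁅ v ⁆`
  -- would be one of its faces. Intersecting over all `v` outside `σ` leaves `σ`.
  all-blocked⇒face : ∀ σ → Simplex K σ → (∀ v → v ∉ σ → ∃ (Blocks σ v)) → IsFaceSimplex K σ
  all-blocked⇒face σ σ∈K blocked =
      -- The extra member `top` makes the family nonempty even when `n` is 0.
      (proj₁ top ∷⁺ tabulate (proj₁ ∘ separate))
    , proj₁ (proj₂ top) ∷ tabulate⁺ (proj₁ ∘ proj₂ ∘ separate)
    , ⊆-antisym
        (λ {x} x∈σ → ∈⋂⁺ (proj₁ top ∷ tabulate (proj₁ ∘ separate)) (proj₂ (proj₂ top) x∈σ ∷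
          tabulate⁺ λ v → proj₁ (proj₂ (proj₂ (separate v))) x∈σ))
        (λ {x} x∈⋂ → decidable-stable (x ∈? σ) λ x∉σ →
          proj₂ (proj₂ (proj₂ (separate x))) x∉σ (member x x∈⋂))
    where
    top = maximal-above σ σ∈K
    separate : ∀ v → ∃[ τ ] (IsMaximal K τ × σ ⊆ τ × (v ∉ σ → v ∉ τ))
    separate v with v ∈? σ
    -- A vertex of `σ` needs no separating; `top` is a default value.
    ... | yes v∈σ = let (τ , τ-max , σ⊆τ) = top in τ , τ-max , σ⊆τ , λ v∉σ → contradiction v∈σ v∉σ
    ... | no v∉σ =
      let (ρ , ρ∈K , σ⊆ρ , ρ∪v∉K) = blocked v v∉σ
          (τ , τ-max , ρ⊆τ)       = maximal-above ρ ρ∈K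
      in τ , τ-max , ⊆-trans σ⊆ρ ρ⊆τ , λ _ v∈τ → ρ∪v∉K (face-closed K
           (λ x∈ → [ ρ⊆τ , (λ x∈v → subst (_∈ τ) (sym (x∈⁅y⁆⇒x≡y v x∈v)) v∈τ) ]′
                     (x∈p∪q⁻ ρ ⁅ v ⁆ x∈))
           (proj₁ τ-max))
    member : ∀ x → x ∈ ⋂ (proj₁ top ∷ tabulate (proj₁ ∘ separate)) → x ∈ proj₁ (separate x)
    member x x∈⋂ with ∈⋂⁻ (proj₁ top ∷ tabulate (proj₁ ∘ separate)) x∈⋂
    ... | _ ∷ x∈τs = tabulate⁻ x∈τs x

  -- Blocking is decidable, so a finite search turns the negative hypothesis into an actual vertex.
  unblocked-vertex : ∀ σ → Simplex K σ → ¬ IsFaceSimplex K σ → ∃[ v ] (v ∉ σ × ¬ ∃ (Blocks σ v))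
  unblocked-vertex σ σ∈K ¬face with any? (λ v → ¬? (v ∈? σ) ×-dec ¬? (blocking? σ v))
  ... | yes found = found
  ... | no none   = contradiction
    (all-blocked⇒face σ σ∈K λ v v∉σ →
      decidable-stable (blocking? σ v) λ free → none (v , v∉σ , free))
    ¬face

  -- All memberships in `K` follow from that of `(τ ∪ σ) ∪ ⁅ v ⁆` by passing to faces; disjointness
  -- from `σ` uses `v ∉ σ`.
  link-apex : ∀ σ (σ∈K : Simplex K σ) v → v ∉ σ → ¬ ∃ (Blocks σ v) →
    ∀ τ → Simplex (link K σ σ∈K) τ → Simplex (link K σ σ∈K) (τ ∪ ⁅ v ⁆)
  link-apex σ σ∈K v v∉σ free τ (τ∈K , τ∩σ≡∅ , τ∪σ∈K) =
      face-closed K (λ x∈ → [ x∈p∪q⁺ ∘ inj₁ ∘ x∈p∪q⁺ ∘ inj₁ , x∈p∪q⁺ ∘ inj₂ ]′ (x∈p∪q⁻ τ ⁅ v ⁆ x∈))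
        extended
    , ⊆-antisym
        (λ {x} x∈ → let (x∈τ∪v , x∈σ) = x∈p∩q⁻ (τ ∪ ⁅ v ⁆) σ x∈ in
          [ (λ x∈τ → subst (x ∈_) τ∩σ≡∅ (x∈p∩q⁺ (x∈τ , x∈σ)))
          , (λ x∈v → contradiction (subst (_∈ σ) (x∈⁅y⁆⇒x≡y v x∈v) x∈σ) v∉σ)
          ]′ (x∈p∪q⁻ τ ⁅ v ⁆ x∈τ∪v))
        (⊆-min _)
    , face-closed K (λ x∈ →
        [ (λ x∈τ∪v → [ x∈p∪q⁺ ∘ inj₁ ∘ x∈p∪q⁺ ∘ inj₁ , x∈p∪q⁺ ∘ inj₂ ]′ (x∈p∪q⁻ τ ⁅ v ⁆ x∈τ∪v))
        , x∈p∪q⁺ ∘ inj₁ ∘ x∈p∪q⁺ ∘ inj₂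
        ]′ (x∈p∪q⁻ (τ ∪ ⁅ v ⁆) σ x∈))
        extended
    where
    extended : Simplex K ((τ ∪ σ) ∪ ⁅ v ⁆)
    -- The simplex `τ ∪ σ` contains `σ`, so it would block `v` if the union were not in `K`.
    extended = decidable-stable (simplex? K _) λ ∉K → free (τ ∪ σ , τ∪σ∈K , q⊆p∪q τ σ , ∉K)

corollary6 : (n : ℕ) (K : SimplicialComplex n) (σ : Subset n) (σ∈K : Simplex K σ) →
    ¬ IsFaceSimplex K σ → Contractible (realization (link K σ σ∈K))
corollary6 n K σ σ∈K ¬face =
  let (v , v∉σ , free) = unblocked-vertex K σ σ∈K ¬face
  in cone-contractible (link K σ σ∈K) v (link-apex K σ σ∈K v v∉σ free)
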